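{- For every $\varepsilon>0$ there is a multiset $X$ of squares of side at most $\frac12$ such that NFDH packs $X$ in one bin but cannot pack $X\cup\{y\}$ in one bin, where $y$ is a square of side $\frac12$, and $a(X)<\frac{5}{16}+\varepsilon$.
   Context: A bin is a unit square. All multisets are finite and squares have positive side. For a multiset $X$ of squares, $a(X)$ is the sum of the areas of its members; $X\cup\{y\}$ denotes $X$ with the additional member $y$. **NFDH (Next-Fit Decreasing Height).** Given a finite multiset of squares of side at most $1$, sort them by non-increasing side. Pack them in this order side by side, from the left, along the bottom of a strip of width $1$ (forming a level) until the next square does not fit horizontally (i.e. the sum of the sides in the level would exceed $1$). Then close that level and start a new level, with this square as its first item, on the horizontal line through the top of the first (tallest) square of the closed level; continue in the same way. The height of a level is the side of its first square. NFDH packs the multiset into one bin if the heights of all levels sum to at most $1$; otherwise it fails (cannot pack it). -}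

module Defs where

open import Algebra.Bundles using (CommutativeRing)
import Algebra.Definitions.RawMonoid as RawMonoidDefinitions
open import Data.Bool.Base using (if_then_else_)
open import Data.List.Base using (List; []; _∷_; map; foldr)
open import Data.List.NonEmpty as List⁺ using (List⁺; _∷_; [_]; _⁺∷ʳ_)
import Data.List.Sort as Sort
open import Data.Nat.Base using (ℕ)
open import Level using (_⊔_) renaming (suc to lsuc)
open import Relation.Binary.Bundles using (DecTotalOrder)
import Relation.Binary.Construct.Flip.EqAndOrd as Flip
import Relation.Binary.Construct.NonStrictToStrict as NonStrictToStrict
open import Relation.Binary.Core using (Rel)
open import Relation.Binary.Structures using (IsDecTotalOrder)
open import Relation.Nullary using (¬_; does)

-- The scalars.  The standard library has no real numbers, so side lengths
-- and ε range over an arbitrary linearly ordered field; classically, ℝ is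
-- one.  As usual with a total inverse, the value of 0# ⁻¹ is unspecified.
record OrderedField c ℓ₁ ℓ₂ : Set (lsuc (c ⊔ ℓ₁ ⊔ ℓ₂)) where
  infix  4 _≤_
  infix  8 _⁻¹
  field
    commutativeRing : CommutativeRing c ℓ₁
  open CommutativeRing commutativeRing public
  field
    _⁻¹             : Carrier → Carrier
    ⁻¹-inverseʳ     : ∀ x → ¬ (x ≈ 0#) → x * x ⁻¹ ≈ 1#
    1≉0             : ¬ (1# ≈ 0#)
    _≤_             : Rel Carrier ℓ₂
    isDecTotalOrder : IsDecTotalOrder _≈_ _≤_
    +-monoˡ-≤       : ∀ z {x y} → x ≤ y → x + z ≤ y + z
    *-nonneg        : ∀ {x y} → 0# ≤ x → 0# ≤ y → 0# ≤ x * y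

  decTotalOrder : DecTotalOrder c ℓ₁ ℓ₂
  decTotalOrder = record { isDecTotalOrder = isDecTotalOrder }

  open IsDecTotalOrder isDecTotalOrder public using (_≤?_)
  open NonStrictToStrict _≈_ _≤_ public using (_<_)

  open RawMonoidDefinitions +-rawMonoid using (_×_)

  fromℕ : ℕ → Carrier
  fromℕ n = n × 1#

  infixl 7 _÷_
  _÷_ : ℕ → ℕ → Carrier
  m ÷ n = fromℕ m * fromℕ n ⁻¹

module NFDH {c ℓ₁ ℓ₂} (F : OrderedField c ℓ₁ ℓ₂) where
  open OrderedField F

  -- A square is given by its side.  A list stands for the multiset of its
  -- members: NFDH sorts its input first, and area is a sum over it.
  Squares : Set c
  Squares = List Carrier

  sum : List Carrier → Carrier
  sum = foldr _+_ 0#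

  area : Squares → Carrier
  area X = sum (map (λ x → x * x) X)

  open Sort (Flip.decTotalOrder decTotalOrder) public
    using () renaming (sort to sortNonIncreasing)

  -- The squares of a level, from left to right.
  Level : Set c
  Level = List⁺ Carrier

  width : Level → Carrier
  width l = sum (List⁺.toList l)

  height : Level → Carrier
  height = List⁺.head

  -- The first argument is the level currently open.
  nextFit : Level → Squares → List Level
  nextFit l []       = l ∷ []
  nextFit l (x ∷ xs) =
    if does (width (l ⁺∷ʳ x) ≤? 1#)
    then nextFit (l ⁺∷ʳ x) xs
    else l ∷ nextFit [ x ] xs

  levelsOfSorted : Squares → List Level
  levelsOfSorted []       = []
  levelsOfSorted (x ∷ xs) = nextFit [ x ] xs

  levels : Squares → List Level
  levels X = levelsOfSorted (sortNonIncreasing X)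

  -- Meaningful only if every side is at most 1#.
  NFDHPacks : Squares → Set ℓ₂
  NFDHPacks X = sum (map height (levels X)) ≤ 1#

{-# OPTIONS --safe #-}
-- X consists of five squares of side s = 1/4 + d, with d > 0 small.  Three of
-- them fit in a level but four do not, so X takes two levels, of total height
-- 2s ≤ 1.  A square of side 1/2 leaves room for only one further square on its
-- level, so the other four squares need two more levels, and the total height
-- is 1/2 + 2s > 1.  The area 5s² tends to 5/16 as d tends to 0.
-- The field may be non-Archimedean, so d is chosen proportional to min(1, ε).
module Submission where

open import Defs
open import Data.List.Base using ([]; _∷_; map; length; replicate)
open import Data.List.NonEmpty.Base using (_∷_; _⁺∷ʳ_; [_])
open import Data.List.Properties using (length-replicate)
open import Data.List.Relation.Binary.Permutation.Propositional
  using (_↭_; ↭-sym)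
open import Data.List.Relation.Binary.Permutation.Propositional.Properties
  using (All-resp-↭; ∈-resp-↭; ↭-length; drop-∷)
open import Data.List.Relation.Unary.All as All using (All; []; _∷_)
import Data.List.Relation.Unary.All.Properties as All
open import Data.List.Relation.Unary.AllPairs using (_∷_)
open import Data.List.Relation.Unary.Any using (here; there)
open import Data.List.Relation.Unary.Sorted.TotalOrder.Properties
  using (Sorted⇒AllPairs)
import Data.List.Sort as Sort
open import Data.Nat.Base using (ℕ; zero; suc)
open import Data.Product using (_×_; _,_; proj₁; ∃-syntax)
open import Data.Sum.Base using (inj₁; inj₂)
open import Relation.Binary.Bundles using (DecTotalOrder)
import Relation.Binary.Construct.Flip.EqAndOrd as Flip
import Relation.Binary.Construct.NonStrictToStrict as NonStrictToStrict
open import Relation.Binary.PropositionalEquality as ≡ using (_≡_)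
open import Relation.Binary.Structures using (IsDecTotalOrder)
open import Relation.Nullary using (¬_; contradiction)
open import Relation.Nullary.Decidable using (dec-true; dec-false)
import Algebra.Properties.Ring as RingProperties
import Algebra.Solver.Ring.NaturalCoefficients.Default as SemiringSolver
import Relation.Binary.Reasoning.Setoid as ≈-Reasoning

-- Permutations of constant lists.

all-equal⇒replicate : ∀ {a} {A : Set a} {x : A} {xs} →
                      All (x ≡_) xs → xs ≡ replicate (length xs) x
all-equal⇒replicate []            = ≡.refl
all-equal⇒replicate (≡.refl ∷ ps) = ≡.cong (_ ∷_) (all-equal⇒replicate ps)

-- A permutation preserves membership and length, and these determine a constant list. Sorting over
-- an abstract order does not compute, so its results are identified from the fact that they are
-- permutations of the input.
↭-replicate-inv : ∀ {a} {A : Set a} {x : A} {xs} n →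
                  xs ↭ replicate n x → xs ≡ replicate n x
↭-replicate-inv {x = x} {xs} n σ = ≡.trans
  (all-equal⇒replicate (All-resp-↭ (↭-sym σ) (All.replicate⁺ n ≡.refl)))
  (≡.cong (λ k → replicate k x) (≡.trans (↭-length σ) (length-replicate n)))

-- Order and division in a linearly ordered field.

module OrderedFieldProperties {c ℓ₁ ℓ₂} (F : OrderedField c ℓ₁ ℓ₂) where
  open OrderedField F
  open IsDecTotalOrder isDecTotalOrder public
    using (antisym; total; ≤-respˡ-≈; ≤-respʳ-≈)
    renaming (refl to ≤-refl; trans to ≤-trans)
  open RingProperties ring using (-‿distribʳ-*; -‿distribˡ-*; -‿involutive)
  open SemiringSolver commutativeSemiring public
    using (Polynomial; solve; con; _:+_; _:*_; _:=_)
  open ≈-Reasoning setoid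

  -- Evaluates to fromℕ n definitionally, unlike con n.
  num : ∀ {k} → ℕ → Polynomial k
  num zero    = con 0
  num (suc n) = con 1 :+ num n

  <⇒≱ : ∀ {x y} → x < y → ¬ (y ≤ x)
  <⇒≱ = NonStrictToStrict.<⇒≱ _≈_ _≤_ antisym

  -- Exhibiting the difference `p` turns an inequality into an equation that the semiring solver can
  -- settle.
  x+p≈y⇒x≤y : ∀ {x y p} → 0# ≤ p → x + p ≈ y → x ≤ y
  x+p≈y⇒x≤y {x} {y} {p} 0≤p x+p≈y =
    ≤-respʳ-≈ (trans (+-comm p x) x+p≈y)
      (≤-respˡ-≈ (+-identityˡ x) (+-monoˡ-≤ x 0≤p))

  x+p≈y⇒x<y : ∀ {x y p} → 0# < p → x + p ≈ y → x < y
  x+p≈y⇒x<y {x} {y} {p} (0≤p , 0≉p) x+p≈y = x+p≈y⇒x≤y 0≤p x+p≈y , λ x≈y →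
    0≉p (begin
      0#              ≈⟨ -‿inverseˡ x ⟨
      - x + x         ≈⟨ +-congˡ (trans x≈y (sym x+p≈y)) ⟩
      - x + (x + p)   ≈⟨ +-assoc (- x) x p ⟨
      (- x + x) + p   ≈⟨ +-congʳ (-‿inverseˡ x) ⟩
      0# + p          ≈⟨ +-identityˡ p ⟩
      p               ∎)

  x≤y⇒0≤y-x : ∀ {x y} → x ≤ y → 0# ≤ y - x
  x≤y⇒0≤y-x {x} x≤y = ≤-respˡ-≈ (-‿inverseʳ x) (+-monoˡ-≤ (- x) x≤y)

  x≤0⇒0≤-x : ∀ {x} → x ≤ 0# → 0# ≤ - x
  x≤0⇒0≤-x {x} x≤0 = ≤-respʳ-≈ (+-identityˡ (- x)) (x≤y⇒0≤y-x x≤0)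

  0≤1 : 0# ≤ 1#
  0≤1 with total 0# 1#
  ... | inj₁ 0≤1 = 0≤1
  -- If `1# ≤ 0#`, then `- 1#` is nonnegative and `1#` is its square.
  ... | inj₂ 1≤0 = ≤-respʳ-≈ (begin
    - 1# * - 1#     ≈⟨ -‿distribˡ-* 1# (- 1#) ⟨
    - (1# * - 1#)   ≈⟨ -‿cong (*-identityˡ (- 1#)) ⟩
    - (- 1#)        ≈⟨ -‿involutive 1# ⟩
    1#              ∎) (*-nonneg (x≤0⇒0≤-x 1≤0) (x≤0⇒0≤-x 1≤0))

  0<1 : 0# < 1#
  0<1 = 0≤1 , λ 0≈1 → 1≉0 (sym 0≈1)

  +-nonneg : ∀ {x y} → 0# ≤ x → 0# ≤ y → 0# ≤ x + y
  +-nonneg 0≤x 0≤y = ≤-trans 0≤x (x+p≈y⇒x≤y 0≤y refl)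

  +-pos-nonneg : ∀ {x y} → 0# < x → 0# ≤ y → 0# < x + y
  +-pos-nonneg (0≤x , 0≉x) 0≤y = +-nonneg 0≤x 0≤y , λ 0≈x+y →
    0≉x (antisym 0≤x (x+p≈y⇒x≤y 0≤y (sym 0≈x+y)))

  fromℕ-nonneg : ∀ n → 0# ≤ fromℕ n
  fromℕ-nonneg zero    = ≤-refl
  fromℕ-nonneg (suc n) = +-nonneg 0≤1 (fromℕ-nonneg n)

  fromℕ-pos : ∀ n → 0# < fromℕ (suc n)
  fromℕ-pos n = +-pos-nonneg 0<1 (fromℕ-nonneg n)

  >⇒≉0 : ∀ {x} → 0# < x → ¬ (x ≈ 0#)
  >⇒≉0 (_ , 0≉x) x≈0 = 0≉x (sym x≈0)

  -- A nonpositive inverse would make `x * - (x ⁻¹)`, which is `- 1#`, nonnegative; a zero inverse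
  -- would give `1# ≈ 0#`.
  ⁻¹-pos : ∀ {x} → 0# < x → 0# < x ⁻¹
  ⁻¹-pos {x} 0<x@(0≤x , _) = 0≤x⁻¹ , λ 0≈x⁻¹ → 1≉0 (begin
      1#       ≈⟨ x*x⁻¹≈1 ⟨
      x * x ⁻¹ ≈⟨ *-congˡ 0≈x⁻¹ ⟨
      x * 0#   ≈⟨ zeroʳ x ⟩
      0#       ∎)
    where
    x*x⁻¹≈1 : x * x ⁻¹ ≈ 1#
    x*x⁻¹≈1 = ⁻¹-inverseʳ x (>⇒≉0 0<x)

    0≤x⁻¹ : 0# ≤ x ⁻¹
    0≤x⁻¹ with total 0# (x ⁻¹)
    ... | inj₁ 0≤x⁻¹ = 0≤x⁻¹
    ... | inj₂ x⁻¹≤0 = contradiction (x+p≈y⇒x≤y 0≤-1 (-‿inverseʳ 1#)) (<⇒≱ 0<1)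
      where
      0≤-1 : 0# ≤ - 1#
      0≤-1 = ≤-respʳ-≈ (trans (sym (-‿distribʳ-* x (x ⁻¹))) (-‿cong x*x⁻¹≈1))
        (*-nonneg 0≤x (x≤0⇒0≤-x x⁻¹≤0))

  *-pos : ∀ {x y} → 0# < x → 0# < y → 0# < x * y
  *-pos {x} {y} 0<x (0≤y , 0≉y) = *-nonneg (proj₁ 0<x) 0≤y , λ 0≈xy →
    0≉y (begin
      0#               ≈⟨ zeroˡ (x ⁻¹) ⟨
      0# * x ⁻¹        ≈⟨ *-congʳ 0≈xy ⟩
      (x * y) * x ⁻¹   ≈⟨ solve 3 (λ x y i → (x :* y) :* i := (x :* i) :* y)
                            refl x y (x ⁻¹) ⟩
      (x * x ⁻¹) * y   ≈⟨ *-congʳ (⁻¹-inverseʳ x (>⇒≉0 0<x)) ⟩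
      1# * y           ≈⟨ *-identityˡ y ⟩
      y                ∎)

  -- Strictness comes from the first term alone, so `y` may be zero. The coefficient of `x` is
  -- `suc m`: callers pass one less than the coefficient they need.
  combination-pos : ∀ {x y} m n → 0# < x → 0# ≤ y →
                    0# < fromℕ (suc m) * x + fromℕ n * y
  combination-pos m n 0<x 0≤y =
    +-pos-nonneg (*-pos (fromℕ-pos m) 0<x) (*-nonneg (fromℕ-nonneg n) 0≤y)

  ÷-unique : ∀ m n {x} → fromℕ (suc n) * x ≈ fromℕ m → x ≈ m ÷ suc n
  ÷-unique m n {x} nx≈m = begin
    x                       ≈⟨ *-identityˡ x ⟨
    1# * x                  ≈⟨ *-congʳ (⁻¹-inverseʳ N (>⇒≉0 (fromℕ-pos n))) ⟨
    (N * N ⁻¹) * x          ≈⟨ solve 3 (λ N i x → (N :* i) :* x := (N :* x) :* i)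
                                 refl N (N ⁻¹) x ⟩
    (N * x) * N ⁻¹          ≈⟨ *-congʳ nx≈m ⟩
    m ÷ suc n               ∎
    where N = fromℕ (suc n)

  -- Take p = min(1, ε) and let `q` be the rest of 1. Carrying `q` along lets later identities avoid
  -- subtraction.
  positive-part-of-1-below : ∀ {ε} → 0# < ε →
    ∃[ p ] ∃[ q ] (0# < p × 0# ≤ q × p + q ≈ 1# × p ≤ ε)
  positive-part-of-1-below {ε} 0<ε with total 1# ε
  ... | inj₁ 1≤ε = 1# , 0# , 0<1 , ≤-refl , +-identityʳ 1# , 1≤ε
  ... | inj₂ ε≤1 = ε , 1# - ε , 0<ε , x≤y⇒0≤y-x ε≤1 , ε+[1-ε]≈1 , ≤-refl
    where
    ε+[1-ε]≈1 : ε + (1# - ε) ≈ 1#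
    ε+[1-ε]≈1 = begin
      ε + (1# - ε)     ≈⟨ solve 3 (λ e o n → e :+ (o :+ n) := o :+ (e :+ n))
                            refl ε 1# (- ε) ⟩
      1# + (ε - ε)     ≈⟨ +-congˡ (-‿inverseʳ ε) ⟩
      1# + 0#          ≈⟨ +-identityʳ 1# ⟩
      1#               ∎

  -- These are p/16 and q/16 for the split p + q = 1 above. Since d + r = 1/16, the numbers 1/4, 1/2
  -- and 1 are the multiples of d + r by 4, 8 and 16.
  sixteenth-split : ∀ {ε} → 0# < ε →
    ∃[ d ] ∃[ r ] (0# < d × 0# ≤ r × fromℕ 16 * (d + r) ≈ 1# × fromℕ 16 * d ≤ ε)
  sixteenth-split 0<ε with p , q , 0<p , 0≤q , p+q≈1 , p≤ε ← positive-part-of-1-below 0<ε =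
    t * p , t * q , *-pos 0<t 0<p , *-nonneg (proj₁ 0<t) 0≤q
    , (begin
      N * (t * p + t * q)   ≈⟨ *-congˡ (distribˡ t p q) ⟨
      N * (t * (p + q))     ≈⟨ cancel (p + q) ⟩
      p + q                 ≈⟨ p+q≈1 ⟩
      1#                    ∎)
    , ≤-respˡ-≈ (sym (cancel p)) p≤ε
    where
    N = fromℕ 16
    t = N ⁻¹
    0<t : 0# < t
    0<t = ⁻¹-pos (fromℕ-pos 15)

    cancel : ∀ x → N * (t * x) ≈ x
    cancel x = begin
      N * (t * x)   ≈⟨ *-assoc N t x ⟨
      (N * t) * x   ≈⟨ *-congʳ (⁻¹-inverseʳ N (>⇒≉0 (fromℕ-pos 15))) ⟩
      1# * x        ≈⟨ *-identityˡ x ⟩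
      x             ∎

-- Sorting and level structure under NFDH.

module NFDHProperties {c ℓ₁ ℓ₂} (F : OrderedField c ℓ₁ ℓ₂) where
  open OrderedField F
  open OrderedFieldProperties F
  open NFDH F
  private
    module ≥ = DecTotalOrder (Flip.decTotalOrder decTotalOrder)
  open Sort (Flip.decTotalOrder decTotalOrder) using (sort-↭; sort-↗)

  sort-replicate : ∀ n x → sortNonIncreasing (replicate n x) ≡ replicate n x
  sort-replicate n x = ↭-replicate-inv n (sort-↭ (replicate n x))

  -- Suppose the sorted list starts with some `x` other than `y`. Then `y` lies in its tail, so
  -- `y ≤ x`, while `x` lies in `ys`, so `x < y`.
  sort-maximum-∷ : ∀ {y ys} → All (_< y) ys →
                   ∃[ zs ] (sortNonIncreasing (y ∷ ys) ≡ y ∷ zs × zs ↭ ys)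
  sort-maximum-∷ {y} {ys} ys<y
    with sortNonIncreasing (y ∷ ys) | sort-↭ (y ∷ ys)
       | Sorted⇒AllPairs ≥.totalOrder (sort-↗ (y ∷ ys))
  ... | [] | σ | _ with () ← ∈-resp-↭ (↭-sym σ) (here ≡.refl)
  ... | x ∷ xs | σ | xs≤x ∷ _
    with ∈-resp-↭ (↭-sym σ) (here ≡.refl) | ∈-resp-↭ σ (here ≡.refl)
  ... | here ≡.refl | _           = xs , ≡.refl , drop-∷ σ
  ... | there _     | here ≡.refl = xs , ≡.refl , drop-∷ σ
  ... | there y∈xs  | there x∈ys  =
    contradiction (All.lookup xs≤x y∈xs) (<⇒≱ (All.lookup ys<y x∈ys))

  sort-∷-replicate : ∀ n {x y} → x < y →
    sortNonIncreasing (y ∷ replicate n x) ≡ y ∷ replicate n x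
  sort-∷-replicate n x<y
    with zs , eq , σ ← sort-maximum-∷ (All.replicate⁺ n x<y) =
    ≡.trans eq (≡.cong (_ ∷_) (↭-replicate-inv n σ))

  nextFit-fits : ∀ l x xs → width (l ⁺∷ʳ x) ≤ 1# →
                 nextFit l (x ∷ xs) ≡ nextFit (l ⁺∷ʳ x) xs
  nextFit-fits l x xs fits
    rewrite dec-true (width (l ⁺∷ʳ x) ≤? 1#) fits = ≡.refl

  nextFit-overflows : ∀ l x xs → 1# < width (l ⁺∷ʳ x) →
                      nextFit l (x ∷ xs) ≡ l ∷ nextFit [ x ] xs
  nextFit-overflows l x xs overflows
    rewrite dec-false (width (l ⁺∷ʳ x) ≤? 1#) (<⇒≱ overflows) = ≡.refl

  -- The hypotheses are the comparisons that NFDH makes on the two inputs. Written as sums of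
  -- explicit lists, they agree definitionally with the widths of the levels.
  module FiveEqual {s h}
    (s<h    : s < h)
    (ss≤1   : sum (replicate 2 s) ≤ 1#)
    (sss≤1  : sum (replicate 3 s) ≤ 1#)
    (1<ssss : 1# < sum (replicate 4 s))
    (hs≤1   : sum (h ∷ replicate 1 s) ≤ 1#)
    (1<hss  : 1# < sum (h ∷ replicate 2 s))
    where
    open ≡.≡-Reasoning

    private
      row : Carrier → ℕ → Level
      row x n = x ∷ replicate n s

    levels-five : levels (replicate 5 s) ≡ row s 2 ∷ row s 1 ∷ []
    levels-five = begin
      levels (replicate 5 s)
        ≡⟨ ≡.cong levelsOfSorted (sort-replicate 5 s) ⟩
      nextFit (row s 0) (replicate 4 s)
        ≡⟨ nextFit-fits (row s 0) s (replicate 3 s) ss≤1 ⟩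
      nextFit (row s 1) (replicate 3 s)
        ≡⟨ nextFit-fits (row s 1) s (replicate 2 s) sss≤1 ⟩
      nextFit (row s 2) (replicate 2 s)
        ≡⟨ nextFit-overflows (row s 2) s (replicate 1 s) 1<ssss ⟩
      row s 2 ∷ nextFit (row s 0) (replicate 1 s)
        ≡⟨ ≡.cong (row s 2 ∷_) (nextFit-fits (row s 0) s [] ss≤1) ⟩
      row s 2 ∷ row s 1 ∷ []
        ∎

    levels-∷-five : levels (h ∷ replicate 5 s) ≡ row h 1 ∷ row s 2 ∷ row s 0 ∷ []
    levels-∷-five = begin
      levels (h ∷ replicate 5 s)
        ≡⟨ ≡.cong levelsOfSorted (sort-∷-replicate 5 s<h) ⟩
      nextFit (row h 0) (replicate 5 s)
        ≡⟨ nextFit-fits (row h 0) s (replicate 4 s) hs≤1 ⟩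
      nextFit (row h 1) (replicate 4 s)
        ≡⟨ nextFit-overflows (row h 1) s (replicate 3 s) 1<hss ⟩
      row h 1 ∷ nextFit (row s 0) (replicate 3 s)
        ≡⟨ ≡.cong (row h 1 ∷_) (nextFit-fits (row s 0) s (replicate 2 s) ss≤1) ⟩
      row h 1 ∷ nextFit (row s 1) (replicate 2 s)
        ≡⟨ ≡.cong (row h 1 ∷_) (nextFit-fits (row s 1) s (replicate 1 s) sss≤1) ⟩
      row h 1 ∷ nextFit (row s 2) (replicate 1 s)
        ≡⟨ ≡.cong (row h 1 ∷_) (nextFit-overflows (row s 2) s [] 1<ssss) ⟩
      row h 1 ∷ row s 2 ∷ row s 0 ∷ []
        ∎

    -- Two levels of height `s` have as total height the width of two squares side by side, so
    -- `ss≤1` applies again.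
    packs-five : NFDHPacks (replicate 5 s)
    packs-five = ≡.subst (λ ls → sum (map height ls) ≤ 1#) (≡.sym levels-five) ss≤1

    -- The level heights are `h`, `s`, `s`: the same sum that kept a third square off the first
    -- level now exceeds the height of the bin.
    ¬packs-∷-five : ¬ NFDHPacks (h ∷ replicate 5 s)
    ¬packs-∷-five packs =
      <⇒≱ 1<hss (≡.subst (λ ls → sum (map height ls) ≤ 1#) levels-∷-five packs)

-- With d + r = 1/16, the sides 5d + 4r = 1/4 + d and 8(d + r) = 1/2, the number
-- 1 and the differences between them are combinations of d and r with natural
-- coefficients, so that every inequality amounts to a semiring identity.
module FiveSquares {c ℓ₁ ℓ₂} (F : OrderedField c ℓ₁ ℓ₂) where
  open OrderedField F
  open OrderedFieldProperties F
  open NFDH F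
  open ≈-Reasoning setoid

  module Sides {d r} (0<d : 0# < d) (0≤r : 0# ≤ r)
               (16[d+r]≈1 : fromℕ 16 * (d + r) ≈ 1#) where

    side : Carrier
    side = fromℕ 5 * d + fromℕ 4 * r

    half≈ : fromℕ 8 * (d + r) ≈ 1 ÷ 2
    half≈ = ÷-unique 1 1 (begin
      fromℕ 2 * (fromℕ 8 * (d + r))
          ≈⟨ solve 1 (λ u → num 2 :* (num 8 :* u) := num 16 :* u) refl (d + r) ⟩
      fromℕ 16 * (d + r)             ≈⟨ 16[d+r]≈1 ⟩
      1#                             ≈⟨ +-identityʳ 1# ⟨
      fromℕ 1                        ∎)

    -- This writes 5/16 as a quadratic form in `d` and `r`, to be compared with the area, which is
    -- quadratic too.
    5/16≈ : fromℕ 5 * (fromℕ 16 * ((d + r) * (d + r))) ≈ 5 ÷ 16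
    5/16≈ = ÷-unique 5 15 (begin
      N * (fromℕ 5 * (N * (u * u)))
        ≈⟨ solve 3 (λ N f u → N :* (f :* (N :* (u :* u))) := f :* ((N :* u) :* (N :* u)))
             refl N (fromℕ 5) u ⟩
      fromℕ 5 * ((N * u) * (N * u))
        ≈⟨ *-congˡ (*-cong 16[d+r]≈1 16[d+r]≈1) ⟩
      fromℕ 5 * (1# * 1#)
        ≈⟨ *-congˡ (*-identityʳ 1#) ⟩
      fromℕ 5 * 1#
        ≈⟨ *-identityʳ (fromℕ 5) ⟩
      fromℕ 5 ∎)
      where
      N = fromℕ 16
      u = d + r

    side-pos : 0# < side
    side-pos = combination-pos 4 4 0<d 0≤r

    side<half : side < 1 ÷ 2
    side<half = x+p≈y⇒x<y (combination-pos 2 4 0<d 0≤r) (trans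
      (solve 2 (λ d r → (num 5 :* d :+ num 4 :* r) :+ (num 3 :* d :+ num 4 :* r)
                        := num 8 :* (d :+ r)) refl d r)
      half≈)

    two-sides≤1 : sum (replicate 2 side) ≤ 1#
    two-sides≤1 = x+p≈y⇒x≤y (proj₁ (combination-pos 5 8 0<d 0≤r)) (trans
      (solve 2 (λ d r → let s = num 5 :* d :+ num 4 :* r in
                        (s :+ (s :+ con 0)) :+ (num 6 :* d :+ num 8 :* r)
                        := num 16 :* (d :+ r)) refl d r)
      16[d+r]≈1)

    three-sides≤1 : sum (replicate 3 side) ≤ 1#
    three-sides≤1 = x+p≈y⇒x≤y (proj₁ (combination-pos 0 4 0<d 0≤r)) (trans
      (solve 2 (λ d r → let s = num 5 :* d :+ num 4 :* r in
                        (s :+ (s :+ (s :+ con 0))) :+ (num 1 :* d :+ num 4 :* r)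
                        := num 16 :* (d :+ r)) refl d r)
      16[d+r]≈1)

    1<four-sides : 1# < sum (replicate 4 side)
    -- The excess is 4d, as each side exceeds 1/4 by `d`. The term with coefficient 0 matches the
    -- form of `combination-pos`.
    1<four-sides = x+p≈y⇒x<y (combination-pos 3 0 0<d 0≤r) (trans
      (+-congʳ (sym 16[d+r]≈1))
      (solve 2 (λ d r → let s = num 5 :* d :+ num 4 :* r in
                        num 16 :* (d :+ r) :+ (num 4 :* d :+ num 0 :* r)
                        := s :+ (s :+ (s :+ (s :+ con 0)))) refl d r))

    half+side≤1 : sum (1 ÷ 2 ∷ replicate 1 side) ≤ 1#
    half+side≤1 = x+p≈y⇒x≤y (proj₁ (combination-pos 2 4 0<d 0≤r)) (trans
      (+-congʳ (+-congʳ (sym half≈))) (trans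
      (solve 2 (λ d r → let s = num 5 :* d :+ num 4 :* r in
                        (num 8 :* (d :+ r) :+ (s :+ con 0)) :+ (num 3 :* d :+ num 4 :* r)
                        := num 16 :* (d :+ r)) refl d r)
      16[d+r]≈1))

    1<half+two-sides : 1# < sum (1 ÷ 2 ∷ replicate 2 side)
    1<half+two-sides = x+p≈y⇒x<y (combination-pos 1 0 0<d 0≤r) (trans
      (+-congʳ (sym 16[d+r]≈1)) (trans
      (solve 2 (λ d r → let s = num 5 :* d :+ num 4 :* r in
                        num 16 :* (d :+ r) :+ (num 2 :* d :+ num 0 :* r)
                        := num 8 :* (d :+ r) :+ (s :+ (s :+ con 0))) refl d r)
      (+-congʳ half≈)))

    -- Multiplying by 16(d + r) = 1 makes 5/16 and 16d homogeneous of degree two. The area stays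
    -- below 5/16 + 16d by `gap`, and 16d is at most `ε`.
    area<5/16+ε : ∀ {ε} → fromℕ 16 * d ≤ ε → area (replicate 5 side) < 5 ÷ 16 + ε
    area<5/16+ε {ε} 16d≤ε = x+p≈y⇒x<y
      (+-pos-nonneg (combination-pos 210 216 (*-pos 0<d 0<d) (*-nonneg (proj₁ 0<d) 0≤r))
                    (x≤y⇒0≤y-x 16d≤ε))
      (begin
        area (replicate 5 side) + (gap + (ε - N * d))
          ≈⟨ +-assoc _ gap (ε - N * d) ⟨
        (area (replicate 5 side) + gap) + (ε - N * d)
          ≈⟨ +-congʳ (solve 2 (λ d r → let s = num 5 :* d :+ num 4 :* r ; q = s :* s in
                (q :+ (q :+ (q :+ (q :+ (q :+ con 0)))))
                  :+ (num 211 :* (d :* d) :+ num 216 :* (d :* r))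
                := num 5 :* (num 16 :* ((d :+ r) :* (d :+ r)))
                   :+ (num 16 :* d) :* (num 16 :* (d :+ r))) refl d r) ⟩
        (fromℕ 5 * (N * (u * u)) + (N * d) * (N * u)) + (ε - N * d)
          ≈⟨ +-congʳ (+-cong 5/16≈ (trans (*-congˡ 16[d+r]≈1) (*-identityʳ (N * d)))) ⟩
        (5 ÷ 16 + N * d) + (ε - N * d)
          ≈⟨ solve 4 (λ a b e n → (a :+ b) :+ (e :+ n) := (a :+ e) :+ (b :+ n))
               refl (5 ÷ 16) (N * d) ε (- (N * d)) ⟩
        (5 ÷ 16 + ε) + (N * d - N * d)
          ≈⟨ +-congˡ (-‿inverseʳ (N * d)) ⟩
        (5 ÷ 16 + ε) + 0#
          ≈⟨ +-identityʳ (5 ÷ 16 + ε) ⟩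
        5 ÷ 16 + ε ∎)
      where
      N = fromℕ 16
      u = d + r
      -- The coefficients come from subtracting 5(5d + 4r)² from 80(d + r)² + 256d(d + r); the terms
      -- in r² cancel.
      gap = fromℕ 211 * (d * d) + fromℕ 216 * (d * r)

proposition3p4 : ∀ {c ℓ₁ ℓ₂} (F : OrderedField c ℓ₁ ℓ₂) →
    let open OrderedField F
        open NFDH F
    in (ε : Carrier) → 0# < ε →
       ∃[ X ] (All (λ x → 0# < x × x ≤ 1 ÷ 2) X
             × NFDHPacks X
             × ¬ NFDHPacks (1 ÷ 2 ∷ X)
             × area X < 5 ÷ 16 + ε)
proposition3p4 F ε 0<ε
  -- The level structure rests on d > 0, r ≥ 0 and d + r = 1/16, while `16d≤ε` makes the area small
  -- enough.
  with d , r , 0<d , 0≤r , 16[d+r]≈1 , 16d≤ε ← OrderedFieldProperties.sixteenth-split F 0<ε =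
  replicate 5 side , All.replicate⁺ 5 (side-pos , proj₁ side<half)
  , packs-five , ¬packs-∷-five , area<5/16+ε 16d≤ε
  where
  open FiveSquares.Sides F 0<d 0≤r 16[d+r]≈1
  open NFDHProperties F
  open FiveEqual side<half two-sides≤1 three-sides≤1 1<four-sides
    half+side≤1 1<half+two-sides
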